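{- Let $n\ge 1$. The poset $(\mathcal{M}_n, \leq_{\mathcal{M}})$ is isomorphic to the disjoint union of the posets $(\mathcal{D}_{2n}(\nu), \leq_D)$, each of which is an interval of the Tamari lattice $(\mathcal{D}_{2n},\leq_D)$, over all words $\nu \in \{N,E\}^{n-1}$ that avoid $EE$ (i.e. have no two consecutive letters $E$). The isomorphism is given by $\phi^{ -1}$. Furthermore, each connected component of $(\mathcal{M}_n,\leq_{\mathcal{M}})$ consists of exactly all the paths in $\mathcal{M}_n$ of a certain class; that is, the vertex sets of the connected components are exactly the sets of paths in $\mathcal{M}_n$ with a given common value of $\mathrm{cls}$.
   Context: Paths: a Motzkin path is a non-empty lattice path in $\mathbb{Z}^2$ starting at $(0,0)$, ending on the diagonal $y=x$, staying weakly above the diagonal, with steps $N=(0,1)$, $E=(1,0)$, $D=(1,1)$. A Dyck path is a Motzkin path without $D$ steps. The size (length) of a path is its number of steps. Paths are viewed as words in $\{N,E,D\}$. $\mathcal{M}_n$ is the set of Motzkin paths of size $n$, $\mathcal{D}_{2n}$ the set of Dyck paths of size $2n$. Order: a valley of a path $P$ is a lattice point $v$ on $P$ preceded by an $E$ step and followed by an $N$ or $D$ step. Given a valley $v$ of a Motzkin path $P$, let $w$ be the next lattice point on $P$ after $v$ with the same horizontal distance to the diagonal as $v$ (the horizontal distance of $(a,b)$ is $b-a$). Exchanging the sub-path of $P$ between $v$ and $w$ with the $E$ step just before $v$ gives a Motzkin path $Q$; one says $Q$ covers $P$. The order $\leq_{\mathcal{M}}$ on $\mathcal{M}_n$ is the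 reflexive transitive closure of this covering relation. The same procedure applied to Dyck paths in $\mathcal{D}_{2n}$ gives the order $\leq_D$ (the Tamari lattice). Connected components of a poset are those of its Hasse diagram. Class: $\mathrm{cls}(P)$ of a Motzkin path $P$ is the increasing sequence of the heights of its diagonal steps, where the height of a diagonal step is the $y$-coordinate of its end point. Type: for $R\in\mathcal{D}_{2n}$, $\mathrm{Type}(R)$ is the word $w$ of length $n-1$ such that $w_i=N$ if the $i$-th north step of $R$ is immediately followed by an east step, and $w_i=E$ otherwise. $\mathcal{D}_{2n}(\nu)$ is the set of $R\in\mathcal{D}_{2n}$ with $\mathrm{Type}(R)=\nu$, with the order $\leq_D$ restricted to it; it is known (Préville-Ratelle and Viennot) that it is always an interval of the Tamari lattice $(\mathcal{D}_{2n},\leq_D)$. The bijection $\phi$: a Dyck path avoiding three consecutive steps $NNN$ is uniquely written $R = N^{a_1}E^{b_1}\cdots N^{a_k}E^{b_k}$ with $a_i\in\{1,2\}$, $b_i\ge 1$. Set $\xi(1)=D$, $\xi(2)=N$, and $\phi(R)=\xi(a_1)E^{b_1-1}\cdots \xi(a_k)E^{b_k-1}$. This $\phi$ is a bijection from Dyck paths avoiding $NNN$ to Motzkin paths; $\phi^{ -1}$ replaces each $D$ by $NE$ and each $N$ by $NNE$. A Dyck path avoids $NNN$ if and only if its type avoids $EE$. -}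

module Defs where

open import Data.Integer.Base as ℤ using (ℤ; 0ℤ)
open import Data.List.Base using (List; []; _∷_; _++_; foldl; length; replicate; take)
open import Data.List.Relation.Unary.All using (All)
open import Data.List.Scans.Base using (scanl)
open import Data.Nat.Base using (ℕ; zero; suc; _+_; _*_; _∸_; _<_; s≤s; z≤n)
import Data.Nat.Properties as ℕ
open import Data.Nat.Solver using (module +-*-Solver)
open import Data.Product.Base using (Σ; Σ-syntax; ∃-syntax; _×_; _,_; proj₁; proj₂)
open import Data.Sum.Base using (_⊎_; inj₁; inj₂)
open import Data.Vec.Base using (Vec; toList)
open import Function.Base using (_on_)
open import Function.Bundles using (_⇔_)
open import Level using (0ℓ)
open import Relation.Binary.Bundles using (Poset)
open import Relation.Binary.Core using (Rel)
open import Relation.Binary.Construct.Closure.Equivalence using (EqClosure)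
open import Relation.Binary.Construct.Closure.ReflexiveTransitive using (Star; ε; _◅_; _◅◅_)
import Relation.Binary.Construct.NonStrictToStrict as NonStrictToStrict
import Relation.Binary.Construct.On as On
open import Relation.Binary.PropositionalEquality
open import Relation.Nullary.Negation using (¬_; contradiction)
open import Relation.Unary using (Pred)

module _ (P : Poset 0ℓ 0ℓ 0ℓ) where
  open Poset P using (Carrier; _≈_; _≤_)
  private module Strict = NonStrictToStrict _≈_ _≤_

  HasseEdge : Rel Carrier 0ℓ
  HasseEdge x y = (x Strict.< y) × (∀ z → ¬ ((x Strict.< z) × (z Strict.< y)))

  Connected : Rel Carrier 0ℓ
  Connected = EqClosure HasseEdge

  IsComponent : Pred Carrier 0ℓ → Set
  IsComponent S = ∃[ x ] (∀ y → S y ⇔ Connected x y)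

  IsInterval : Pred Carrier 0ℓ → Set
  IsInterval S = ∃[ l ] ∃[ u ] (l ≤ u) × (∀ x → S x ⇔ ((l ≤ x) × (x ≤ u)))

data Fibrewise {I : Set} {C : I → Set} (R : ∀ i → Rel (C i) 0ℓ) : Rel (Σ I C) 0ℓ where
  fibre : ∀ {i x y} → R i x y → Fibrewise R (i , x) (i , y)

-- Disjoint union; the indices themselves carry no order.
⨄ : {I : Set} → (I → Poset 0ℓ 0ℓ 0ℓ) → Poset 0ℓ 0ℓ 0ℓ
⨄ {I} P = record
  { Carrier = Σ[ i ∈ I ] Poset.Carrier (P i)
  ; _≈_     = Fibrewise (λ i → Poset._≈_ (P i))
  ; _≤_     = Fibrewise (λ i → Poset._≤_ (P i))
  ; isPartialOrder = record
    { isPreorder = record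
      { isEquivalence = record
        { refl  = λ {(i , _)} → fibre (Poset.Eq.refl (P i))
        ; sym   = λ { (fibre {i} p) → fibre (Poset.Eq.sym (P i) p) }
        ; trans = λ { (fibre {i} p) (fibre q) → fibre (Poset.Eq.trans (P i) p q) }
        }
      ; reflexive = λ { (fibre {i} p) → fibre (Poset.reflexive (P i) p) }
      ; trans     = λ { (fibre {i} p) (fibre q) → fibre (Poset.trans (P i) p q) }
      }
    ; antisym = λ { (fibre {i} p) (fibre q) → fibre (Poset.antisym (P i) p q) }
    }
  }

data Step : Set where
  N E D : Step

Point : Set
Point = ℤ × ℤ

origin : Point
origin = 0ℤ , 0ℤ

infixl 5 _▹_

_▹_ : Point → Step → Point
(x , y) ▹ N = x , ℤ.suc y
(x , y) ▹ E = ℤ.suc x , y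
(x , y) ▹ D = ℤ.suc x , ℤ.suc y

endpoint : Point → List Step → Point
endpoint = foldl _▹_

hdist : Point → ℤ
hdist (a , b) = b ℤ.- a

record IsMotzkin (w : List Step) : Set where
  field
    nonEmpty      : w ≢ []
    weaklyAbove   : All (λ (x , y) → x ℤ.≤ y) (scanl _▹_ origin w)
    endOnDiagonal : proj₁ (endpoint origin w) ≡ proj₂ (endpoint origin w)

record Motzkin (n : ℕ) : Set where
  field
    word      : List Step
    isMotzkin : IsMotzkin word
    size      : length word ≡ n

record Dyck (m : ℕ) : Set where
  field
    word      : List Step
    isMotzkin : IsMotzkin word
    noD       : All (_≢ D) word
    size      : length word ≡ m

-- The covering relation: P = before · E · sub · after is turned into
-- Q = before · sub · E · after.  Here v is the valley and `sub` is the part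
-- of P from v to w, so w is the endpoint of `sub` and the points reached by
-- its proper non-empty prefixes are those strictly between v and w.
record _⋖_ (P Q : List Step) : Set where
  field
    before after : List Step
    first        : Step
    rest         : List Step

  sub : List Step
  sub = first ∷ rest

  v : Point
  v = endpoint origin (before ++ E ∷ [])

  field
    P≡      : P ≡ before ++ E ∷ sub ++ after
    Q≡      : Q ≡ before ++ sub ++ E ∷ after
    valley  : first ≢ E
    returns : hdist (endpoint v sub) ≡ hdist v
    isNext  : ∀ s t → sub ≡ s ++ t → s ≢ [] → t ≢ [] → hdist (endpoint v s) ≢ hdist v

-- Antisymmetry of the reflexive transitive closure of _⋖_: each covering step
-- strictly increases the sum of the heights of the east steps, where height
-- is counted from the second argument k.
module _ where
  private
    rise : List Step → ℕ
    rise []      = 0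
    rise (E ∷ w) = rise w
    rise (N ∷ w) = suc (rise w)
    rise (D ∷ w) = suc (rise w)

    rank : List Step → ℕ → ℕ
    rank []      k = 0
    rank (E ∷ w) k = k + rank w k
    rank (N ∷ w) k = rank w (suc k)
    rank (D ∷ w) k = rank w (suc k)

    rank-++ : ∀ u w k → rank (u ++ w) k ≡ rank u k + rank w (rise u + k)
    rank-++ []      w k = refl
    rank-++ (E ∷ u) w k = trans (cong (k +_) (rank-++ u w k)) (sym (ℕ.+-assoc k _ _))
    rank-++ (N ∷ u) w k = trans (rank-++ u w (suc k))
      (cong (λ z → rank u (suc k) + rank w z) (ℕ.+-suc (rise u) k))
    rank-++ (D ∷ u) w k = trans (rank-++ u w (suc k))
      (cong (λ z → rank u (suc k) + rank w z) (ℕ.+-suc (rise u) k))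

    rise-pos : ∀ {s} w → s ≢ E → 0 < rise (s ∷ w)
    rise-pos {N} w _   = s≤s z≤n
    rise-pos {E} w s≢E = contradiction refl s≢E
    rise-pos {D} w _   = s≤s z≤n

    local : ∀ S C k → 0 < rise S → rank (E ∷ S ++ C) k < rank (S ++ E ∷ C) k
    local S C k 0<S
      rewrite rank-++ S C k | rank-++ S (E ∷ C) k
      = subst₂ _<_ refl
          (solve 4 (λ a r k' c → r :+ (k' :+ (a :+ c)) := a :+ ((r :+ k') :+ c)) refl
            (rank S k) (rise S) k (rank C (rise S + k)))
          (ℕ.m<n+m (k + (rank S k + rank C (rise S + k))) 0<S)
      where open +-*-Solver

    ⋖⇒rank< : ∀ {P Q} → P ⋖ Q → rank P 0 < rank Q 0
    ⋖⇒rank< c = subst₂ _<_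
      (sym (trans (cong (λ w → rank w 0) P≡) (rank-++ before (E ∷ sub ++ after) 0)))
      (sym (trans (cong (λ w → rank w 0) Q≡) (rank-++ before (sub ++ E ∷ after) 0)))
      (ℕ.+-monoʳ-< (rank before 0)
        (local sub after (rise before + 0) (rise-pos rest valley)))
      where open _⋖_ c

    module _ {A : Set} (word : A → List Step) where
      ≤⇒rank : ∀ {x y} → Star (_⋖_ on word) x y →
               (x ≡ y) ⊎ (rank (word x) 0 < rank (word y) 0)
      ≤⇒rank ε = inj₁ refl
      ≤⇒rank (c ◅ cs) with ≤⇒rank cs
      ... | inj₁ refl = inj₂ (⋖⇒rank< c)
      ... | inj₂ lt   = inj₂ (ℕ.<-trans (⋖⇒rank< c) lt)

  ⋖*-antisym : {A : Set} (word : A → List Step) → ∀ {x y} →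
               Star (_⋖_ on word) x y → Star (_⋖_ on word) y x → x ≡ y
  ⋖*-antisym word p q with ≤⇒rank word p | ≤⇒rank word q
  ... | inj₁ x≡y | _        = x≡y
  ... | inj₂ _   | inj₁ y≡x = sym y≡x
  ... | inj₂ lt  | inj₂ gt  = contradiction gt (ℕ.<-asym lt)

pathPoset : {A : Set} → (A → List Step) → Poset 0ℓ 0ℓ 0ℓ
pathPoset {A} word = record
  { Carrier = A
  ; _≈_     = _≡_
  ; _≤_     = Star (_⋖_ on word)
  ; isPartialOrder = record
    { isPreorder = record
      { isEquivalence = isEquivalence
      ; reflexive     = λ { refl → ε }
      ; trans         = _◅◅_
      }
    ; antisym = ⋖*-antisym word
    }
  }

MotzkinPoset : ℕ → Poset 0ℓ 0ℓ 0ℓ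
MotzkinPoset n = pathPoset (Motzkin.word {n})

-- Indexed by half the size: the Tamari lattice on Dyck paths of size 2n.
Tamari : ℕ → Poset 0ℓ 0ℓ 0ℓ
Tamari n = pathPoset (Dyck.word {2 * n})

diagonalHeights : Point → List Step → List ℤ
diagonalHeights p []      = []
diagonalHeights p (N ∷ w) = diagonalHeights (p ▹ N) w
diagonalHeights p (E ∷ w) = diagonalHeights (p ▹ E) w
diagonalHeights p (D ∷ w) = proj₂ (p ▹ D) ∷ diagonalHeights (p ▹ D) w

cls : ∀ {n} → Motzkin n → List ℤ
cls P = diagonalHeights origin (Motzkin.word P)

data Letter : Set where
  N E : Letter

-- One letter for every north step, the last one included.
northLetters : List Step → List Letter
northLetters []          = []
northLetters (N ∷ E ∷ w) = N ∷ northLetters w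
northLetters (N ∷ w)     = E ∷ northLetters w
northLetters (E ∷ w)     = northLetters w
northLetters (D ∷ w)     = northLetters w

-- A Dyck path of size 2n has n north steps, so this drops exactly the letter
-- of the last one.
Type : ∀ n → Dyck (2 * n) → List Letter
Type n R = take (n ∸ 1) (northLetters (Dyck.word R))

HasType : ∀ n → Vec Letter (n ∸ 1) → Pred (Dyck (2 * n)) 0ℓ
HasType n ν R = Type n R ≡ toList ν

DyckOfType : ∀ n → Vec Letter (n ∸ 1) → Poset 0ℓ 0ℓ 0ℓ
DyckOfType n ν = On.poset (Tamari n) (proj₁ {B = HasType n ν})

AvoidsEE : ∀ {k} → Vec Letter k → Set
AvoidsEE ν = ∀ u w → toList ν ≢ u ++ E ∷ E ∷ w

-- The graph of φ on words: in a block N^a E^(b+1), the run N^a becomes ξ(a)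
-- (ξ(1) = D, ξ(2) = N) and E^(b+1) becomes E^b.  Only the words
-- N^a₁ E^b₁ ⋯ N^aₖ E^bₖ with aᵢ ∈ {1,2} and bᵢ ≥ 1 have an image, and their
-- decomposition into blocks is unique.
data φ⟨_⟩≡_ : List Step → List Step → Set where
  []  : φ⟨ [] ⟩≡ []
  N¹E : ∀ b {R P} → φ⟨ R ⟩≡ P →
        φ⟨ N ∷ replicate (suc b) E ++ R ⟩≡ (D ∷ replicate b E ++ P)
  N²E : ∀ b {R P} → φ⟨ R ⟩≡ P →
        φ⟨ N ∷ N ∷ replicate (suc b) E ++ R ⟩≡ (N ∷ replicate b E ++ P)

{-# OPTIONS --safe #-}

-- A covering step slides an E over the excursion behind it.  It keeps the order
-- of the N and D steps of a Motzkin path P, and this order determines both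
-- cls P (given the size) and the type of φ⁻¹ P.  All paths with a given order
-- lie between the one in which each N is directly followed by an E and the one
-- in which all E come last.  The first is linked to each of them by slides over
-- the excursions D and N E alone; these increase the sum of the heights of the E
-- steps by exactly one, so they are edges of the Hasse diagram.
--
-- In a Dyck path a slide can only turn letters N of the type into E, hence sets
-- of paths of given type are convex.  A slide that changes no letter, applied to
-- φ⁻¹ P, is the image of a slide of P.

module Submission where

open import Defs
open import Algebra.Bundles using (AbelianGroup)
open import Data.Integer.Base as ℤ using (ℤ; 0ℤ)
import Data.Integer.Properties as ℤ
open import Algebra.Properties.Group (AbelianGroup.group ℤ.+-0-abelianGroup) using (identityˡ-unique)
open import Data.List.Base using (List; []; _∷_; _++_; _∷ʳ_; length; replicate; take)
open import Data.List.Properties using (++-assoc; length-++-sucʳ; ∷-injectiveˡ; ∷-injectiveʳ; ∷ʳ-injectiveˡ)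
open import Data.List.Relation.Binary.Pointwise as Pointwise using (Pointwise; []; _∷_)
open import Data.List.Relation.Unary.All as All using (All; []; _∷_)
open import Data.List.Scans.Base using (scanl)
open import Data.Nat.Base using (ℕ; zero; suc; _+_; _*_; _≤_; _<_; _∸_; s≤s; z≤n)
import Data.Nat.Properties as ℕ
open import Data.Product.Base using (Σ; Σ-syntax; ∃-syntax; _×_; _,_; proj₁; proj₂)
open import Data.Sum.Base using (_⊎_; inj₁; inj₂)
open import Data.Vec.Base using (Vec; toList; fromList)
open import Data.Vec.Properties using (toList-injective; toList∘fromList; length-toList; cast-is-id)
open import Function.Base using (_∘_; _on_; id)
open import Function.Bundles using (_⇔_; mk⇔; Equivalence)
open import Level using (0ℓ)
open import Relation.Binary.Bundles using (Poset)
open import Relation.Binary.Core using (Rel; _⇒_)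
import Relation.Binary.Construct.Closure.Equivalence as EqClosure
open import Relation.Binary.Construct.Closure.Symmetric using (fwd)
open import Relation.Binary.Construct.Closure.ReflexiveTransitive as Star using (Star; ε; _◅_; _◅◅_)
open import Relation.Binary.Morphism.Structures using (IsOrderIsomorphism)
open import Relation.Binary.PropositionalEquality
open import Relation.Binary.PropositionalEquality.WithK using (≡-irrelevant)
open import Relation.Nullary.Negation using (¬_; contradiction)
open import Relation.Unary using (Pred; Satisfiable)

-- Words, excursions and slides

-- Words from horizontal distance h down to the diagonal.
data Path : ℕ → List Step → Set where
  []  : Path 0 []
  N∷_ : ∀ {h w} → Path (suc h) w → Path h (N ∷ w)
  E∷_ : ∀ {h w} → Path h w → Path (suc h) (E ∷ w)
  D∷_ : ∀ {h w} → Path h w → Path h (D ∷ w)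

-- Words that start h above a level and reach it at their end only.
data FirstPassage : ℕ → List Step → Set where
  []  : FirstPassage 0 []
  N∷_ : ∀ {h w} → FirstPassage (2 + h) w → FirstPassage (suc h) (N ∷ w)
  E∷_ : ∀ {h w} → FirstPassage h w → FirstPassage (suc h) (E ∷ w)
  D∷_ : ∀ {h w} → FirstPassage (suc h) w → FirstPassage (suc h) (D ∷ w)

-- The part of a path between a valley and the next point at its level. D keeps the horizontal
-- distance, so an excursion that starts with D is D alone.
data Prime : Pred (List Step) 0ℓ where
  D   : Prime (D ∷ [])
  N∷_ : ∀ {w} → FirstPassage 1 w → Prime (N ∷ w)

data Peak : Pred (List Step) 0ℓ where
  D  : Peak (D ∷ [])
  NE : Peak (N ∷ E ∷ [])

-- The kind of excursion is a parameter: `Prime` gives the covering relation, `Peak` the slides that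
-- yield Hasse edges, and both share their invariants.
data Slide (F : Pred (List Step) 0ℓ) : Rel (List Step) 0ℓ where
  here  : ∀ {s} → F s → ∀ w → Slide F (E ∷ s ++ w) (s ++ E ∷ w)
  there : ∀ x {u w} → Slide F u w → Slide F (x ∷ u) (x ∷ w)

infix 4 _⊲_ _⊲ₚ_

_⊲_ _⊲ₚ_ : Rel (List Step) 0ℓ
_⊲_  = Slide Prime
_⊲ₚ_ = Slide Peak

peak⇒prime : ∀ {s} → Peak s → Prime s
peak⇒prime D  = D
peak⇒prime NE = N∷ E∷ []

⊲ₚ⇒⊲ : _⊲ₚ_ ⇒ _⊲_
⊲ₚ⇒⊲ (here s w)  = here (peak⇒prime s) w
⊲ₚ⇒⊲ (there x r) = there x (⊲ₚ⇒⊲ r)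

module _ {F : Pred (List Step) 0ℓ} where

  slide-prefix : ∀ b {u w} → Slide F u w → Slide F (b ++ u) (b ++ w)
  slide-prefix []      r = r
  slide-prefix (x ∷ b) r = there x (slide-prefix b r)

  slide-split : ∀ {u w} → Slide F u w →
    ∃[ b ] ∃[ s ] ∃[ a ] F s × u ≡ b ++ E ∷ s ++ a × w ≡ b ++ s ++ E ∷ a
  slide-split (here {s} f w) = [] , s , w , f , refl , refl
  slide-split (there x r) with slide-split r
  ... | b , s , a , f , refl , refl = x ∷ b , s , a , f , refl , refl

  slides-cons : ∀ x {u w} → Star (Slide F) u w → Star (Slide F) (x ∷ u) (x ∷ w)
  slides-cons x = Star.gmap (x ∷_) (there x)

-- Horizontal distances

-- The distance above a level `c` is kept as a natural number, so that it matches the indices of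
-- `Path` (where `c` is 0) and of `FirstPassage` (where `c` is the level of the valley).
record At (c : ℤ) (h : ℕ) (p : Point) : Set where
  constructor at
  field hdist≡ : hdist p ≡ ℤ.+ h ℤ.+ c

at-start : ∀ p → At (hdist p) 0 p
at-start p = at (sym (ℤ.+-identityˡ (hdist p)))

at-0 : ∀ {c p} → At c 0 p → hdist p ≡ c
at-0 (at e) = trans e (ℤ.+-identityˡ _)

at-suc : ∀ {c h p} → At c (suc h) p → hdist p ≢ c
at-suc {c} {h} (at e) q with identityˡ-unique (ℤ.+ suc h) c (trans (sym e) q)
... | ()

hdist-N : ∀ p → hdist (p ▹ N) ≡ ℤ.suc (hdist p)
hdist-N (x , y) = ℤ.+-assoc ℤ.1ℤ y (ℤ.- x)

hdist-E : ∀ p → hdist (p ▹ E) ≡ ℤ.pred (hdist p)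
hdist-E (x , y) = begin
  y ℤ.- (ℤ.1ℤ ℤ.+ x)           ≡⟨ cong (λ z → y ℤ.+ z) (ℤ.neg-distrib-+ ℤ.1ℤ x) ⟩
  y ℤ.+ (ℤ.-1ℤ ℤ.+ ℤ.- x)      ≡⟨ ℤ.+-assoc y ℤ.-1ℤ (ℤ.- x) ⟨
  (y ℤ.+ ℤ.-1ℤ) ℤ.+ ℤ.- x      ≡⟨ cong (λ z → z ℤ.+ ℤ.- x) (ℤ.+-comm y ℤ.-1ℤ) ⟩
  (ℤ.-1ℤ ℤ.+ y) ℤ.+ ℤ.- x      ≡⟨ ℤ.+-assoc ℤ.-1ℤ y (ℤ.- x) ⟩
  ℤ.-1ℤ ℤ.+ (y ℤ.- x)          ∎
  where open ≡-Reasoning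

-- D reaches the same point as E followed by N, whose effects cancel.
hdist-D : ∀ p → hdist (p ▹ D) ≡ hdist p
hdist-D p@(x , y) = begin
  hdist (p ▹ D)               ≡⟨ hdist-N (ℤ.suc x , y) ⟩
  ℤ.suc (hdist (p ▹ E))       ≡⟨ cong ℤ.suc (hdist-E p) ⟩
  ℤ.suc (ℤ.pred (hdist p))    ≡⟨ ℤ.suc-pred (hdist p) ⟩
  hdist p                     ∎
  where open ≡-Reasoning

at-N : ∀ {c h p} → At c h p → At c (suc h) (p ▹ N)
at-N {c} {h} {p} (at e) = at (trans (hdist-N p) (trans (cong ℤ.suc e) (sym (ℤ.suc-+ h c))))

at-E : ∀ {c h p} → At c (suc h) p → At c h (p ▹ E)
at-E {c} {h} {p} (at e) = at (trans (hdist-E p)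
  (trans (cong ℤ.pred (trans e (ℤ.suc-+ h c))) (ℤ.pred-suc _)))

at-D : ∀ {c h p} → At c h p → At c h (p ▹ D)
at-D {p = p} (at e) = at (trans (hdist-D p) e)

-- Motzkin paths as inductive words

Above : Pred Point 0ℓ
Above (x , y) = x ℤ.≤ y

at⇒above : ∀ {h p} → At 0ℤ h p → Above p
at⇒above (at e) = ℤ.0≤i-j⇒j≤i
  (subst (0ℤ ℤ.≤_) (sym (trans e (ℤ.+-identityʳ _))) (ℤ.+≤+ z≤n))

above-E : ∀ {p} → At 0ℤ 0 p → ¬ Above (p ▹ E)
above-E {p} (at e) a with subst (0ℤ ℤ.≤_) (trans (hdist-E p) (cong ℤ.pred e)) (ℤ.i≤j⇒0≤j-i a)
... | ()

path-above : ∀ {h p w} → At 0ℤ h p → Path h w → All Above (scanl _▹_ p w)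
path-above e []     = at⇒above e ∷ []
path-above e (N∷ q) = at⇒above e ∷ path-above (at-N e) q
path-above e (E∷ q) = at⇒above e ∷ path-above (at-E e) q
path-above e (D∷ q) = at⇒above e ∷ path-above (at-D e) q

path-end : ∀ {h p w} → At 0ℤ h p → Path h w → At 0ℤ 0 (endpoint p w)
path-end e []     = e
path-end e (N∷ q) = path-end (at-N e) q
path-end e (E∷ q) = path-end (at-E e) q
path-end e (D∷ q) = path-end (at-D e) q

mkPath : ∀ h {p} w → At 0ℤ h p → All Above (scanl _▹_ p w) →
         hdist (endpoint p w) ≡ 0ℤ → Path h w
mkPath zero    []      e _       _ = []
mkPath (suc h) []      e _       f = contradiction f (at-suc e)
mkPath h       (N ∷ w) e (_ ∷ a) f = N∷ mkPath (suc h) w (at-N e) a f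
mkPath h       (D ∷ w) e (_ ∷ a) f = D∷ mkPath h w (at-D e) a f
mkPath (suc h) (E ∷ w) e (_ ∷ a) f = E∷ mkPath h w (at-E e) a f
-- The tail is split only to let `scanl` compute far enough to expose the point behind the E.
mkPath zero    (E ∷ []) e (_ ∷ a ∷ _) f = contradiction a (above-E e)
mkPath zero    (E ∷ w@(_ ∷ _)) e (_ ∷ a ∷ _) f = contradiction a (above-E e)

isMotzkin⇒path : ∀ {w} → IsMotzkin w → Path 0 w
isMotzkin⇒path {w} m = mkPath 0 w (at refl) weaklyAbove (ℤ.i≡j⇒i-j≡0 (sym endOnDiagonal))
  where open IsMotzkin m

path⇒isMotzkin : ∀ {w} → w ≢ [] → Path 0 w → IsMotzkin w
path⇒isMotzkin {w} ne p = record
  { nonEmpty      = ne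
  ; weaklyAbove   = path-above (at refl) p
  ; endOnDiagonal = sym (ℤ.i-j≡0⇒i≡j _ _ (at-0 (path-end {w = w} (at refl) p)))
  }

-- Excursions and the covering relation

passage-end : ∀ {c h p w} → At c h p → FirstPassage h w → At c 0 (endpoint p w)
passage-end e []     = e
passage-end e (N∷ q) = passage-end (at-N e) q
passage-end e (E∷ q) = passage-end (at-E e) q
passage-end e (D∷ q) = passage-end (at-D e) q

-- Index 0 admits the empty word only, so the step that reaches the level is the last one.
passage-inside : ∀ {c h p w} → At c (suc h) p → FirstPassage (suc h) w →
  ∀ s t → w ≡ s ++ t → t ≢ [] → hdist (endpoint p s) ≢ c
passage-inside e q      []      t _    _  = at-suc e
passage-inside e (N∷ q) (_ ∷ s) t refl ne = passage-inside (at-N e) q s t refl ne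
passage-inside e (D∷ q) (_ ∷ s) t refl ne = passage-inside (at-D e) q s t refl ne
passage-inside {h = suc h} e (E∷ q) (_ ∷ s) t refl ne = passage-inside (at-E e) q s t refl ne
passage-inside {h = zero} e (E∷ []) (_ ∷ []) [] eq ne = contradiction refl ne

mkPassage : ∀ {c} h {p} w → At c (suc h) p → hdist (endpoint p w) ≡ c →
  (∀ s t → w ≡ s ++ t → t ≢ [] → hdist (endpoint p s) ≢ c) → FirstPassage (suc h) w
mkPassage h       []      e r _ = contradiction r (at-suc e)
mkPassage h       (N ∷ w) e r i =
  N∷ mkPassage (suc h) w (at-N e) r (λ s t eq → i (N ∷ s) t (cong (N ∷_) eq))
mkPassage h       (D ∷ w) e r i =
  D∷ mkPassage h w (at-D e) r (λ s t eq → i (D ∷ s) t (cong (D ∷_) eq))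
mkPassage (suc h) (E ∷ w) e r i =
  E∷ mkPassage h w (at-E e) r (λ s t eq → i (E ∷ s) t (cong (E ∷_) eq))
mkPassage zero    (E ∷ [])    e r i = E∷ []
-- The prefix E already reaches level `c` although the word goes on, which `i` forbids.
mkPassage zero    (E ∷ x ∷ w) e r i =
  contradiction (at-0 (at-E e)) (i (E ∷ []) (x ∷ w) refl (λ ()))

mkPrime : ∀ {p} x w → x ≢ E → hdist (endpoint p (x ∷ w)) ≡ hdist p →
  (∀ s t → x ∷ w ≡ s ++ t → s ≢ [] → t ≢ [] → hdist (endpoint p s) ≢ hdist p) →
  Prime (x ∷ w)
mkPrime     E w       x≢E r i = contradiction refl x≢E
mkPrime {p} N w       x≢E r i =
  N∷ mkPassage 0 w (at-N (at-start p)) r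
       (λ s t eq → i (N ∷ s) t (cong (N ∷_) eq) (λ ()))
mkPrime     D []      x≢E r i = D
mkPrime {p} D (y ∷ w) x≢E r i =
  contradiction (hdist-D p) (i (D ∷ []) (y ∷ w) refl (λ ()) (λ ()))

⋖⇒⊲ : _⋖_ ⇒ _⊲_
⋖⇒⊲ c = subst₂ _⊲_ (sym P≡) (sym Q≡)
  (slide-prefix before (here (mkPrime {v} first rest valley returns isNext) after))
  where open _⋖_ c

⊲⇒⋖ : _⊲_ ⇒ _⋖_
⊲⇒⋖ r with slide-split r
... | b , _ , a , D , refl , refl = record
  { before = b ; after = a ; first = D ; rest = []
  ; P≡ = refl ; Q≡ = refl ; valley = λ ()
  ; returns = hdist-D (endpoint origin (b ++ E ∷ []))
  ; isNext = λ { [] _ _ ne _ → contradiction refl ne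
               ; (_ ∷ []) [] _ _ ne → contradiction refl ne }
  }
... | b , _ , a , (N∷_ {w} q) , refl , refl = record
  { before = b ; after = a ; first = N ; rest = w
  ; P≡ = refl ; Q≡ = refl ; valley = λ ()
  ; returns = at-0 (passage-end at-1 q)
  ; isNext = λ { [] _ _ ne _ → contradiction refl ne
               ; (_ ∷ s) t refl _ ne → passage-inside at-1 q s t refl ne }
  }
  where
  p = endpoint origin (b ++ E ∷ [])
  at-1 : At (hdist p) 1 (p ▹ N)
  at-1 = at-N (at-start p)

slide-path : ∀ {h u w} → u ⊲ w → Path h u → Path h w
slide-path (here D w)       (E∷ (D∷ p)) = D∷ (E∷ p)
slide-path {suc h} (here (N∷ q) w) (E∷ (N∷ p)) = N∷ lift q p
  where
  -- Without the E in front of it the excursion runs one level higher, and the E behind it comes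
  -- back down.
  lift : ∀ {k s} → FirstPassage k s → Path (k + h) (s ++ w) → Path (suc (k + h)) (s ++ E ∷ w)
  lift []     p      = E∷ p
  lift (N∷ q) (N∷ p) = N∷ lift q p
  lift (E∷ q) (E∷ p) = E∷ lift q p
  lift (D∷ q) (D∷ p) = D∷ lift q p
slide-path (there N r) (N∷ p) = N∷ slide-path r p
slide-path (there E r) (E∷ p) = E∷ slide-path r p
slide-path (there D r) (D∷ p) = D∷ slide-path r p

slide-length : ∀ {F u w} → Slide F u w → length u ≡ length w
slide-length (here {s} _ w) = sym (length-++-sucʳ s E w)
slide-length (there x r)    = cong suc (slide-length r)

-- The inverse of φ

inflate : List Step → List Step
inflate []      = []
inflate (N ∷ w) = N ∷ N ∷ E ∷ inflate w
inflate (E ∷ w) = E ∷ inflate w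
inflate (D ∷ w) = N ∷ E ∷ inflate w

inflate-++ : ∀ u w → inflate (u ++ w) ≡ inflate u ++ inflate w
inflate-++ []      w = refl
inflate-++ (N ∷ u) w = cong (λ z → N ∷ N ∷ E ∷ z) (inflate-++ u w)
inflate-++ (E ∷ u) w = cong (E ∷_) (inflate-++ u w)
inflate-++ (D ∷ u) w = cong (λ z → N ∷ E ∷ z) (inflate-++ u w)

inflate-injective : ∀ {u w} → inflate u ≡ inflate w → u ≡ w
inflate-injective {[]}    {[]}    _  = refl
inflate-injective {[]}    {N ∷ _} ()
inflate-injective {[]}    {E ∷ _} ()
inflate-injective {[]}    {D ∷ _} ()
inflate-injective {N ∷ _} {N ∷ _} eq =
  cong (N ∷_) (inflate-injective (∷-injectiveʳ (∷-injectiveʳ (∷-injectiveʳ eq))))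
inflate-injective {E ∷ _} {E ∷ _} eq = cong (E ∷_) (inflate-injective (∷-injectiveʳ eq))
inflate-injective {D ∷ _} {D ∷ _} eq =
  cong (D ∷_) (inflate-injective (∷-injectiveʳ (∷-injectiveʳ eq)))

inflate-path : ∀ {h w} → Path h w → Path h (inflate w)
inflate-path []     = []
inflate-path (N∷ p) = N∷ (N∷ (E∷ inflate-path p))
inflate-path (E∷ p) = E∷ inflate-path p
inflate-path (D∷ p) = N∷ (E∷ inflate-path p)

deflate-path : ∀ {h} w → Path h (inflate w) → Path h w
deflate-path []      []               = []
deflate-path (N ∷ w) (N∷ (N∷ (E∷ p))) = N∷ deflate-path w p
deflate-path (E ∷ w) (E∷ p)           = E∷ deflate-path w p
deflate-path (D ∷ w) (N∷ (E∷ p))      = D∷ deflate-path w p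

inflate-noD : ∀ w → All (_≢ D) (inflate w)
inflate-noD []      = []
inflate-noD (N ∷ w) = (λ ()) ∷ (λ ()) ∷ (λ ()) ∷ inflate-noD w
inflate-noD (E ∷ w) = (λ ()) ∷ inflate-noD w
inflate-noD (D ∷ w) = (λ ()) ∷ (λ ()) ∷ inflate-noD w

-- N, D and E become three, two and one letters. There are `h` more E than N, and the summand `h`
-- makes up for this surplus.
inflate-length : ∀ {h w} → Path h w → length (inflate w) + h ≡ 2 * length w
inflate-length []     = refl
inflate-length {h} {_ ∷ w} (N∷ p) = begin
  3 + length (inflate w) + h         ≡⟨ cong (2 +_) (ℕ.+-suc (length (inflate w)) h) ⟨
  2 + (length (inflate w) + suc h)   ≡⟨ cong (2 +_) (inflate-length p) ⟩
  2 + 2 * length w                   ≡⟨ ℕ.*-suc 2 (length w) ⟨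
  2 * suc (length w)                 ∎
  where open ≡-Reasoning
inflate-length {suc h} {_ ∷ w} (E∷ p) = begin
  1 + length (inflate w) + suc h     ≡⟨ cong suc (ℕ.+-suc (length (inflate w)) h) ⟩
  2 + (length (inflate w) + h)       ≡⟨ cong (2 +_) (inflate-length p) ⟩
  2 + 2 * length w                   ≡⟨ ℕ.*-suc 2 (length w) ⟨
  2 * suc (length w)                 ∎
  where open ≡-Reasoning
inflate-length {h} {_ ∷ w} (D∷ p) = begin
  2 + length (inflate w) + h         ≡⟨ cong (2 +_) (inflate-length p) ⟩
  2 + 2 * length w                   ≡⟨ ℕ.*-suc 2 (length w) ⟨
  2 * suc (length w)                 ∎
  where open ≡-Reasoning

inflate-graph : ∀ {w} → Path 0 w → φ⟨ inflate w ⟩≡ w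
inflate-graph p with blocks p
  where
  -- A leading run of E belongs to the block of the letter before it, so it is split off and handed
  -- on to that letter. The bound `b ≤ h` leaves no such run on the diagonal.
  blocks : ∀ {h w} → Path h w → ∃[ b ] ∃[ w′ ] ∃[ R ]
    w ≡ replicate b E ++ w′ × inflate w ≡ replicate b E ++ R × φ⟨ R ⟩≡ w′ × b ≤ h
  blocks [] = 0 , [] , [] , refl , refl , [] , z≤n
  blocks (E∷ p) with blocks p
  ... | b , w′ , R , refl , eq , g , b≤h = suc b , w′ , R , refl , cong (E ∷_) eq , g , s≤s b≤h
  blocks (N∷ p) with blocks p
  ... | b , w′ , R , refl , eq , g , _ =
    0 , _ , _ , refl , cong (λ z → N ∷ N ∷ E ∷ z) eq , N²E b g , z≤n
  blocks (D∷ p) with blocks p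
  ... | b , w′ , R , refl , eq , g , _ =
    0 , _ , _ , refl , cong (λ z → N ∷ E ∷ z) eq , N¹E b g , z≤n
... | zero , _ , _ , refl , eq , g , _ = subst (φ⟨_⟩≡ _) (sym eq) g

-- Slides under inflation

inflate-passage : ∀ {h w} → FirstPassage h w → FirstPassage h (inflate w)
inflate-passage []     = []
inflate-passage (N∷ q) = N∷ N∷ E∷ inflate-passage q
inflate-passage (E∷ q) = E∷ inflate-passage q
inflate-passage (D∷ q) = N∷ E∷ inflate-passage q

deflate-passage : ∀ {h} w → FirstPassage h (inflate w) → FirstPassage h w
deflate-passage []      []             = []
deflate-passage (N ∷ w) (N∷ N∷ E∷ q)   = N∷ deflate-passage w q
deflate-passage (E ∷ w) (E∷ q)         = E∷ deflate-passage w q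
deflate-passage (D ∷ w) (N∷ E∷ q)      = D∷ deflate-passage w q

inflate-prime : ∀ {s} → Prime s → Prime (inflate s)
inflate-prime D      = N∷ E∷ []
inflate-prime (N∷ q) = N∷ N∷ E∷ inflate-passage q

deflate-prime : ∀ s → Prime (inflate s) → Prime s
deflate-prime (N ∷ s) (N∷ N∷ E∷ q) = N∷ deflate-passage s q
deflate-prime (D ∷ s) (N∷ E∷ q) with deflate-passage s q
... | [] = D

inflate-slide : ∀ {u w} → u ⊲ w → inflate u ⊲ inflate w
inflate-slide (here {s} f w) = subst₂ _⊲_
  (cong (E ∷_) (sym (inflate-++ s w))) (sym (inflate-++ s (E ∷ w)))
  (here (inflate-prime f) (inflate w))
inflate-slide (there N r) = there N (there N (there E (inflate-slide r)))
inflate-slide (there E r) = there E (inflate-slide r)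
inflate-slide (there D r) = there N (there E (inflate-slide r))

-- Every block N N E, N E or E ends with its only E.
inflate-cut : ∀ w {x y} → inflate w ≡ x ++ E ∷ y →
  ∃[ u ] ∃[ v ] w ≡ u ++ v × x ∷ʳ E ≡ inflate u × y ≡ inflate v
inflate-cut []      {[]}    ()
inflate-cut []      {_ ∷ _} ()
inflate-cut (E ∷ w) {[]} refl = E ∷ [] , w , refl , refl , refl
inflate-cut (E ∷ w) {_ ∷ x} eq with ∷-injectiveˡ eq | inflate-cut w (∷-injectiveʳ eq)
... | refl | u , v , refl , p , q = E ∷ u , v , refl , cong (E ∷_) p , q
inflate-cut (D ∷ w) {_ ∷ []} refl = D ∷ [] , w , refl , refl , refl
inflate-cut (D ∷ w) {_ ∷ _ ∷ x} eq
  with ∷-injectiveˡ eq | ∷-injectiveˡ (∷-injectiveʳ eq) | inflate-cut w (∷-injectiveʳ (∷-injectiveʳ eq))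
... | refl | refl | u , v , refl , p , q = D ∷ u , v , refl , cong (λ z → N ∷ E ∷ z) p , q
inflate-cut (N ∷ w) {_ ∷ _ ∷ []} refl = N ∷ [] , w , refl , refl , refl
inflate-cut (N ∷ w) {_ ∷ _ ∷ _ ∷ x} eq
  with ∷-injectiveˡ eq | ∷-injectiveˡ (∷-injectiveʳ eq) | ∷-injectiveˡ (∷-injectiveʳ (∷-injectiveʳ eq))
     | inflate-cut w (∷-injectiveʳ (∷-injectiveʳ (∷-injectiveʳ eq)))
... | refl | refl | refl | u , v , refl , p , q = N ∷ u , v , refl , cong (λ z → N ∷ N ∷ E ∷ z) p , q

-- The level is reached from above, which only an E can do.
passage-last : ∀ {h w} → FirstPassage (suc h) w → ∃[ x ] w ≡ x ∷ʳ E
passage-last (N∷ q) with passage-last q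
... | x , refl = N ∷ x , refl
passage-last {zero}  (E∷ []) = [] , refl
passage-last {suc _} (E∷ q) with passage-last q
... | x , refl = E ∷ x , refl
passage-last (D∷ q) with passage-last q
... | x , refl = D ∷ x , refl

-- Inflated words contain no D, so the excursion starts with N and ends with E, and that E closes a
-- block.
prime-cut : ∀ w {s a} → Prime s → inflate w ≡ s ++ a →
  ∃[ u ] ∃[ v ] w ≡ u ++ v × s ≡ inflate u × a ≡ inflate v
prime-cut (N ∷ w) D ()
prime-cut (E ∷ w) D ()
prime-cut (D ∷ w) D ()
prime-cut w {a = a} (N∷ q) eq with passage-last q
... | x , refl = inflate-cut w {N ∷ x} (trans eq (cong (N ∷_) (++-assoc x (E ∷ []) a)))

-- Types

-- The letters of the inflated word, the last one included. They record exactly the order of the N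
-- and D steps.
letters : List Step → List Letter
letters []      = []
letters (N ∷ w) = E ∷ N ∷ letters w
letters (E ∷ w) = letters w
letters (D ∷ w) = N ∷ letters w

northLetters-inflate : ∀ w → northLetters (inflate w) ≡ letters w
northLetters-inflate []      = refl
northLetters-inflate (N ∷ w) = cong (λ z → E ∷ N ∷ z) (northLetters-inflate w)
northLetters-inflate (E ∷ w) = northLetters-inflate w
northLetters-inflate (D ∷ w) = cong (N ∷_) (northLetters-inflate w)

letters-++ : ∀ u w → letters (u ++ w) ≡ letters u ++ letters w
letters-++ []      w = refl
letters-++ (N ∷ u) w = cong (λ z → E ∷ N ∷ z) (letters-++ u w)
letters-++ (E ∷ u) w = letters-++ u w
letters-++ (D ∷ u) w = cong (N ∷_) (letters-++ u w)

slide-letters : ∀ {F u w} → Slide F u w → letters u ≡ letters w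
slide-letters (here {s} _ w) = trans (letters-++ s w) (sym (letters-++ s (E ∷ w)))
slide-letters (there N r) = cong (λ z → E ∷ N ∷ z) (slide-letters r)
slide-letters (there E r) = slide-letters r
slide-letters (there D r) = cong (N ∷_) (slide-letters r)

-- The second letter of each N pays for one E; the summand `h` accounts for the E steps in surplus.
letters-length : ∀ {h w} → Path h w → length (letters w) + h ≡ length w
letters-length []     = refl
letters-length {h} {_ ∷ w} (N∷ p) =
  cong suc (trans (sym (ℕ.+-suc (length (letters w)) h)) (letters-length p))
letters-length {suc h} {_ ∷ w} (E∷ p) =
  trans (ℕ.+-suc (length (letters w)) h) (cong suc (letters-length p))
letters-length (D∷ p) = cong suc (letters-length p)

-- Letters under slides

peek : List Step → Letter
peek (E ∷ _) = N
peek _       = E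

-- `northLetters` looks two steps ahead; naming the letter of the first N by `peek` permits
-- induction one step at a time.
northLetters-N : ∀ w → northLetters (N ∷ w) ≡ peek w ∷ northLetters w
northLetters-N []      = refl
northLetters-N (N ∷ w) = refl
northLetters-N (E ∷ w) = refl
northLetters-N (D ∷ w) = refl

data _⊑_ : Rel Letter 0ℓ where
  refl : ∀ {l} → l ⊑ l
  N⊑E  : N ⊑ E

⊑-antisym : ∀ {l m} → l ⊑ m → m ⊑ l → l ≡ m
⊑-antisym refl _ = refl

-- Only a slide at the very front changes the first step. It starts with E there, so the letter
-- before it is N, the least one.
peek-slide : ∀ {F u w} → Slide F u w → peek u ⊑ peek w
peek-slide (here {s} _ w) with peek (s ++ E ∷ w)
... | N = refl
... | E = N⊑E
peek-slide (there N r) = refl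
peek-slide (there E r) = refl
peek-slide (there D r) = refl

prime-peek : ∀ {s} → Prime s → ∀ w → peek (s ++ w) ≡ E
prime-peek D      w = refl
prime-peek (N∷ _) w = refl

passage-peek : ∀ {h s} → FirstPassage (suc h) s → ∀ u w → peek (s ++ u) ≡ peek (s ++ w)
passage-peek (N∷ _) u w = refl
passage-peek (E∷ _) u w = refl
passage-peek (D∷ _) u w = refl

-- The excursion ends with E, so the E put behind it follows no N directly and changes no letter.
passage-northLetters : ∀ {h s} → FirstPassage (suc h) s → ∀ w →
  northLetters (s ++ E ∷ w) ≡ northLetters (s ++ w)
N∷passage-northLetters : ∀ {h s} → FirstPassage (suc h) s → ∀ w →
  northLetters (N ∷ s ++ E ∷ w) ≡ northLetters (N ∷ s ++ w)

passage-northLetters         (N∷ q)  w = N∷passage-northLetters q w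
passage-northLetters {zero}  (E∷ []) w = refl
passage-northLetters {suc _} (E∷ q)  w = passage-northLetters q w
passage-northLetters         (D∷ q)  w = passage-northLetters q w

N∷passage-northLetters {s = s} q w = begin
  northLetters (N ∷ s ++ E ∷ w)                  ≡⟨ northLetters-N (s ++ E ∷ w) ⟩
  peek (s ++ E ∷ w) ∷ northLetters (s ++ E ∷ w)
    ≡⟨ cong₂ _∷_ (passage-peek q (E ∷ w) w) (passage-northLetters q w) ⟩
  peek (s ++ w) ∷ northLetters (s ++ w)          ≡⟨ northLetters-N (s ++ w) ⟨
  northLetters (N ∷ s ++ w)                      ∎
  where open ≡-Reasoning

prime-northLetters : ∀ {s} → Prime s → ∀ w → northLetters (s ++ E ∷ w) ≡ northLetters (s ++ w)
prime-northLetters D      w = refl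
prime-northLetters (N∷ q) w = N∷passage-northLetters q w

⊑*-reflexive : ∀ {k l} → k ≡ l → Pointwise _⊑_ k l
⊑*-reflexive refl = Pointwise.refl refl

slide-northLetters : ∀ {u w} → u ⊲ w → Pointwise _⊑_ (northLetters u) (northLetters w)
slide-northLetters (here f w) = ⊑*-reflexive (sym (prime-northLetters f w))
slide-northLetters (there E r) = slide-northLetters r
slide-northLetters (there D r) = slide-northLetters r
slide-northLetters (there N {u} {w} r) = subst₂ (Pointwise _⊑_)
  (sym (northLetters-N u)) (sym (northLetters-N w))
  (peek-slide r ∷ slide-northLetters r)

⊑-trans : ∀ {k l m} → k ⊑ l → l ⊑ m → k ⊑ m
⊑-trans refl q    = q
⊑-trans N⊑E  refl = N⊑E

slides-northLetters : ∀ {u w} → Star _⊲_ u w → Pointwise _⊑_ (northLetters u) (northLetters w)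
slides-northLetters ε        = ⊑*-reflexive refl
slides-northLetters (r ◅ rs) =
  Pointwise.transitive ⊑-trans (slide-northLetters r) (slides-northLetters rs)

⊑*-antisym : ∀ {k l} → Pointwise _⊑_ k l → Pointwise _⊑_ l k → k ≡ l
⊑*-antisym p q = Pointwise.Pointwise-≡⇒≡ (Pointwise.antisymmetric ⊑-antisym p q)

-- Slides that start from an inflated word

prime-turns-letter : ∀ {s} → Prime s → ∀ a {l} →
  northLetters (N ∷ s ++ a) ≢ N ∷ l
prime-turns-letter {s} f a eq
  with trans (sym (prime-peek f a)) (∷-injectiveˡ (trans (sym (northLetters-N (s ++ a))) eq))
... | ()

-- Inversion by explicit equations, because the index `s ++ w` of `here` does not unify with an
-- inflated word.
slide-uncons : ∀ {F x z R} → Slide F (x ∷ z) R →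
  (∃[ y ] R ≡ x ∷ y × Slide F z y) ⊎
  (∃[ s ] ∃[ a ] x ≡ E × F s × z ≡ s ++ a × R ≡ s ++ E ∷ a)
slide-uncons (here {s} f a) = inj₂ (s , a , refl , f , refl , refl)
slide-uncons (there x r)    = inj₁ (_ , refl , r)

-- An E that slides away from directly behind an N turns the letter of that N
-- from N into E.  So if the type is preserved, the sliding E is not the E of a
-- block N E or N N E.
deflate-slide : ∀ w {R} → inflate w ⊲ R → northLetters R ≡ letters w →
                ∃[ u ] R ≡ inflate u × w ⊲ u
deflate-slide (E ∷ w) r eq with slide-uncons r
... | inj₁ (_ , refl , r′) with deflate-slide w r′ eq
...   | u , refl , t = E ∷ u , refl , there E t
deflate-slide (E ∷ w) r eq | inj₂ (s , a , _ , f , z≡ , refl) with prime-cut w f z≡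
... | u , v , refl , refl , refl =
  u ++ E ∷ v , sym (inflate-++ u (E ∷ v)) , here (deflate-prime u f) v
deflate-slide (D ∷ w) r eq with slide-uncons r
... | inj₁ (_ , refl , r₁) with slide-uncons r₁
...   | inj₂ (s , a , _ , f , _ , refl) = contradiction eq (prime-turns-letter f (E ∷ a))
...   | inj₁ (_ , refl , r₂) with deflate-slide w r₂ (∷-injectiveʳ eq)
...     | u , refl , t = D ∷ u , refl , there D t
deflate-slide (N ∷ w) r eq with slide-uncons r
... | inj₁ (_ , refl , r₁) with slide-uncons r₁
...   | inj₁ (_ , refl , r₂) with slide-uncons r₂
...     | inj₂ (s , a , _ , f , _ , refl) =
  contradiction (∷-injectiveʳ eq) (prime-turns-letter f (E ∷ a))
...     | inj₁ (_ , refl , r₃) with deflate-slide w r₃ (∷-injectiveʳ (∷-injectiveʳ eq))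
...       | u , refl , t = N ∷ u , refl , there N t

deflate-slides : ∀ {R} u {w} → Star _⊲_ (inflate u) R → R ≡ inflate w →
                 letters u ≡ letters w → Star _⊲_ u w
deflate-slides u ε eq _ rewrite inflate-injective {u} eq = ε
deflate-slides u {w} (_◅_ {j = R} r rs) refl eq with deflate-slide u r same
  where
  -- Letters only grow along slides, and they agree at both ends of the chain, so they are constant
  -- on it.
  same : northLetters R ≡ letters u
  same = ⊑*-antisym
    (subst (Pointwise _⊑_ _) (trans (northLetters-inflate w) (sym eq)) (slides-northLetters rs))
    (subst (λ l → Pointwise _⊑_ l _) (northLetters-inflate u) (slide-northLetters r))
... | v , refl , t = t ◅ deflate-slides v rs refl (trans (sym (slide-letters t)) eq)

-- Types that avoid E E

-- Concatenations of the words N and E N, the types of N E and N N E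
data Blocks : Pred (List Letter) 0ℓ where
  []   : Blocks []
  N∷_  : ∀ {l} → Blocks l → Blocks (N ∷ l)
  EN∷_ : ∀ {l} → Blocks l → Blocks (E ∷ N ∷ l)

letters-blocks : ∀ w → Blocks (letters w)
letters-blocks []      = []
letters-blocks (N ∷ w) = EN∷ letters-blocks w
letters-blocks (E ∷ w) = letters-blocks w
letters-blocks (D ∷ w) = N∷ letters-blocks w

blocks-avoid : ∀ {l} → Blocks l → ∀ u w → l ≢ u ++ E ∷ E ∷ w
blocks-avoid (N∷ b)  (_ ∷ u)     w refl = blocks-avoid b u w refl
blocks-avoid (EN∷ b) (_ ∷ _ ∷ u) w refl = blocks-avoid b u w refl
blocks-avoid []      []      w ()
blocks-avoid []      (_ ∷ _) w ()

-- Without E E each E is followed by N, and the appended N, the letter of the last north step,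
-- serves an E at the end.
avoid-blocks : ∀ l → (∀ u w → l ≢ u ++ E ∷ E ∷ w) → Blocks (l ∷ʳ N)
avoid-blocks []          av = N∷ []
avoid-blocks (N ∷ l)     av = N∷ avoid-blocks l (λ u w eq → av (N ∷ u) w (cong (N ∷_) eq))
avoid-blocks (E ∷ [])    av = EN∷ []
avoid-blocks (E ∷ N ∷ l) av =
  EN∷ avoid-blocks l (λ u w eq → av (E ∷ N ∷ u) w (cong (λ z → E ∷ N ∷ z) eq))
avoid-blocks (E ∷ E ∷ l) av = contradiction refl (av [] l)

-- A factor N N N or an N in last position would give a letter E that no N follows. All other words
-- without D are cut into N N E, N E and E.
deflate : ∀ R → All (_≢ D) R → Blocks (northLetters R) → ∃[ w ] R ≡ inflate w
deflate []              _                 _ = [] , refl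
deflate (E ∷ R)         (_ ∷ a)           b with deflate R a b
... | w , refl = E ∷ w , refl
deflate (N ∷ E ∷ R)     (_ ∷ _ ∷ a)       (N∷ b) with deflate R a b
... | w , refl = D ∷ w , refl
deflate (N ∷ N ∷ E ∷ R) (_ ∷ _ ∷ _ ∷ a)   (EN∷ b) with deflate R a b
... | w , refl = N ∷ w , refl
deflate (D ∷ R)         (d ∷ _)           _ = contradiction refl d
deflate (N ∷ D ∷ R)     (_ ∷ d ∷ _)       _ = contradiction refl d
deflate (N ∷ N ∷ D ∷ R) (_ ∷ _ ∷ d ∷ _)   _ = contradiction refl d

-- Behind the last north step the path is still above the diagonal, so it goes on, and only with E
-- steps.
northLetters-last : ∀ {h w} → Path h w → All (_≢ D) w →
  northLetters w ≡ [] ⊎ ∃[ l ] northLetters w ≡ l ∷ʳ N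
northLetters-last []     _       = inj₁ refl
northLetters-last (E∷ p) (_ ∷ a) = northLetters-last p a
northLetters-last (D∷ p) (d ∷ _) = contradiction refl d
northLetters-last {w = N ∷ w} (N∷ p) (_ ∷ a) rewrite northLetters-N w
  with northLetters-last p a
... | inj₂ (l , eq) = inj₂ (peek w ∷ l , cong (peek w ∷_) eq)
northLetters-last {w = N ∷ E ∷ w} (N∷ p) (_ ∷ a) | inj₁ eq = inj₂ ([] , cong (N ∷_) eq)
northLetters-last {w = N ∷ N ∷ w} (N∷ p) (_ ∷ a) | inj₁ eq
  with trans (sym (northLetters-N w)) eq
... | ()
northLetters-last {w = N ∷ D ∷ w} (N∷ p) (_ ∷ d ∷ _) | inj₁ eq = contradiction refl d

northLetters-length : ∀ {h w} → Path h w → All (_≢ D) w →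
                      2 * length (northLetters w) + h ≡ length w
northLetters-length [] _ = refl
northLetters-length {suc h} {E ∷ w} (E∷ p) (_ ∷ a) =
  trans (ℕ.+-suc (2 * length (northLetters w)) h) (cong suc (northLetters-length p a))
northLetters-length {h} {D ∷ w} (D∷ p) (d ∷ _) = contradiction refl d
northLetters-length {h} {N ∷ w} (N∷ p) (_ ∷ a) = begin
  2 * length (northLetters (N ∷ w)) + h    ≡⟨ cong (λ l → 2 * length l + h) (northLetters-N w) ⟩
  2 * suc k + h                            ≡⟨ cong (_+ h) (ℕ.*-suc 2 k) ⟩
  2 + 2 * k + h                            ≡⟨ cong suc (ℕ.+-suc (2 * k) h) ⟨
  suc (2 * k + suc h)                      ≡⟨ cong suc (northLetters-length p a) ⟩
  suc (length w)                           ∎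
  where
  open ≡-Reasoning
  k = length (northLetters w)

-- The extreme paths of a given type

bot : List Letter → List Step
bot (N ∷ l)     = D ∷ bot l
bot (E ∷ N ∷ l) = N ∷ E ∷ bot l
bot _           = []

-- `h` counts the E steps still owed; they are all put off to the end.
top : ℕ → List Letter → List Step
top h (N ∷ l)     = D ∷ top h l
top h (E ∷ N ∷ l) = N ∷ top (suc h) l
top h _           = replicate h E

bot-path : ∀ {l} → Blocks l → Path 0 (bot l)
bot-path []      = []
bot-path (N∷ b)  = D∷ bot-path b
bot-path (EN∷ b) = N∷ (E∷ bot-path b)

bot-letters : ∀ {l} → Blocks l → letters (bot l) ≡ l
bot-letters []      = refl
bot-letters (N∷ b)  = cong (N ∷_) (bot-letters b)
bot-letters (EN∷ b) = cong (λ z → E ∷ N ∷ z) (bot-letters b)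

descend : ∀ h → Path h (replicate h E)
descend zero    = []
descend (suc h) = E∷ descend h

top-path : ∀ h {l} → Blocks l → Path h (top h l)
top-path h []      = descend h
top-path h (N∷ b)  = D∷ top-path h b
top-path h (EN∷ b) = N∷ top-path (suc h) b

top-letters : ∀ h {l} → Blocks l → letters (top h l) ≡ l
top-letters zero    []      = refl
top-letters (suc h) []      = top-letters h []
top-letters h       (N∷ b)  = cong (N ∷_) (top-letters h b)
top-letters h       (EN∷ b) = cong (λ z → E ∷ N ∷ z) (top-letters (suc h) b)

-- The E next to the peak goes first, and every E of the run passes the same peak.
peak-up : ∀ {s} → Peak s → ∀ h w → Star _⊲ₚ_ (replicate h E ++ s ++ w) (s ++ replicate h E ++ w)
peak-up f zero    w = ε
peak-up f (suc h) w = slides-cons E (peak-up f h w) ◅◅ here f _ ◅ ε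

-- A suffix at distance `h` has `h` E steps more than the least word with its letters; these wait in
-- front. Once they have passed the first peak they form the run for the rest, joined by the E of
-- the peak in the case of N.
bot-minimum : ∀ {h w} → Path h w → Star _⊲ₚ_ (replicate h E ++ bot (letters w)) w
bot-minimum []         = ε
bot-minimum {h} (N∷ p) = peak-up NE h _ ◅◅ slides-cons N (bot-minimum p)
bot-minimum (E∷ p)     = slides-cons E (bot-minimum p)
bot-minimum {h} (D∷ p) = peak-up D h _ ◅◅ slides-cons D (bot-minimum p)

top-+ : ∀ k h {l} → Blocks l → top (k + h) l ≡ top k l ++ replicate h E
top-+ zero    h []      = refl
top-+ (suc k) h []      = cong (E ∷_) (top-+ k h [])
top-+ k       h (N∷ b)  = cong (D ∷_) (top-+ k h b)
top-+ k       h (EN∷ b) = cong (N ∷_) (top-+ (suc k) h b)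

top-passage : ∀ k {l} → Blocks l → FirstPassage (suc k) (top (suc k) l)
top-passage zero    []      = E∷ []
top-passage (suc k) []      = E∷ top-passage k []
top-passage k       (N∷ b)  = D∷ top-passage k b
top-passage k       (EN∷ b) = N∷ top-passage (suc k) b

-- The E passes leading D steps one by one. From the first N on, everything up to the matching E is
-- a single excursion, and one slide suffices.
top-suc : ∀ h {l} → Blocks l → Star _⊲_ (E ∷ top h l) (top (suc h) l)
top-suc h []     = ε
top-suc h (N∷ b) = here D _ ◅ slides-cons D (top-suc h b)
top-suc h (EN∷ b) = subst₂ _⊲_
  (cong (λ z → E ∷ N ∷ z) (sym (top-+ 1 h b))) (cong (N ∷_) (sym (top-+ 1 (suc h) b)))
  (here (N∷ top-passage 0 b) (replicate h E)) ◅ ε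

top-maximum : ∀ {h w} → Path h w → Star _⊲_ w (top h (letters w))
top-maximum []     = ε
top-maximum (N∷ p) = slides-cons N (top-maximum p)
top-maximum {suc h} {E ∷ w} (E∷ p) = slides-cons E (top-maximum p) ◅◅ top-suc h (letters-blocks w)
top-maximum (D∷ p) = slides-cons D (top-maximum p)

-- Sums of the heights of E steps

area : ℕ → List Step → ℕ
area k []      = 0
area k (N ∷ w) = area (suc k) w
area k (E ∷ w) = k + area k w
area k (D ∷ w) = area (suc k) w

peak-area : ∀ {u w} → u ⊲ₚ w → ∀ k → area k w ≡ suc (area k u)
peak-area (here D w)  k = refl
peak-area (here NE w) k = refl
peak-area (there N r) k = peak-area r (suc k)
peak-area (there D r) k = peak-area r (suc k)
peak-area (there E r) k = trans (cong (k +_) (peak-area r k)) (ℕ.+-suc k _)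

area-insert : ∀ s w k → k + area k (s ++ w) ≤ area k (s ++ E ∷ w)
area-insert []      w k = ℕ.≤-refl
area-insert (E ∷ s) w k = ℕ.+-monoʳ-≤ k (area-insert s w k)
area-insert (N ∷ s) w k = ℕ.<⇒≤ (area-insert s w (suc k))
area-insert (D ∷ s) w k = ℕ.<⇒≤ (area-insert s w (suc k))

slide-area : ∀ {u w} → u ⊲ w → ∀ k → area k u < area k w
slide-area (here D w)          k = ℕ.≤-refl
-- The leading N makes the inequality strict: the rest of the excursion starts at height `suc k`.
slide-area (here (N∷_ {s} _) w) k = area-insert s w (suc k)
slide-area (there N r) k = slide-area r (suc k)
slide-area (there D r) k = slide-area r (suc k)
slide-area (there E r) k = ℕ.+-monoʳ-< k (slide-area r k)

-- Classes

-- The class read off the letters: E N stands for an N step and N for a D step, both of which raise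
-- the height by one.
heights : ℤ → List Letter → List ℤ
heights y (N ∷ l)     = ℤ.suc y ∷ heights (ℤ.suc y) l
heights y (E ∷ N ∷ l) = heights (ℤ.suc y) l
heights y _           = []

diagonalHeights-letters : ∀ p w → diagonalHeights p w ≡ heights (proj₂ p) (letters w)
diagonalHeights-letters p       []      = refl
diagonalHeights-letters p       (N ∷ w) = diagonalHeights-letters (p ▹ N) w
diagonalHeights-letters p       (E ∷ w) = diagonalHeights-letters (p ▹ E) w
diagonalHeights-letters (_ , y) (D ∷ w) = cong (ℤ.suc y ∷_) (diagonalHeights-letters (_ , ℤ.suc y) w)

i<suc[i] : ∀ i → i ℤ.< ℤ.suc i
i<suc[i] i = ℤ.suc[i]≤j⇒i<j ℤ.≤-refl

heights-above : ∀ y {l} → Blocks l → All (y ℤ.<_) (heights y l)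
heights-above y []      = []
heights-above y (N∷ b)  =
  i<suc[i] y ∷ All.map (ℤ.<-trans (i<suc[i] y)) (heights-above (ℤ.suc y) b)
heights-above y (EN∷ b) = All.map (ℤ.<-trans (i<suc[i] y)) (heights-above (ℤ.suc y) b)

heights-fresh : ∀ y {l z} → Blocks l → y ∷ z ≢ heights y l
heights-fresh y b eq = ℤ.<-irrefl refl (All.head (subst (All (y ℤ.<_)) (sym eq) (heights-above y b)))

-- A leading D step records height `suc y`, while after a leading N step all recorded heights exceed
-- it. N steps behind the last D step leave no height; there the length decides.
heights-injective : ∀ y {k l} → Blocks k → Blocks l → heights y k ≡ heights y l →
                    length k ≡ length l → k ≡ l
heights-injective y []     []     _  _  = refl
heights-injective y (N∷ b) (N∷ c) eq len =
  cong (N ∷_) (heights-injective _ b c (∷-injectiveʳ eq) (ℕ.suc-injective len))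
heights-injective y (EN∷ b) (EN∷ c) eq len =
  cong (λ z → E ∷ N ∷ z) (heights-injective _ b c eq (ℕ.suc-injective (ℕ.suc-injective len)))
heights-injective y (N∷ b)  (EN∷ c) eq _ = contradiction eq (heights-fresh _ c)
heights-injective y (EN∷ b) (N∷ c)  eq _ = contradiction (sym eq) (heights-fresh _ b)

-- Posets of paths

isMotzkin-irrelevant : ∀ {w} (p q : IsMotzkin w) → p ≡ q
-- Functions into ⊥ are definitionally equal, so `nonEmpty` can be taken from `p` on both sides.
isMotzkin-irrelevant p q = cong₂
  (λ a e → record { nonEmpty = P.nonEmpty ; weaklyAbove = a ; endOnDiagonal = e })
  (All.irrelevant ℤ.≤-irrelevant P.weaklyAbove Q.weaklyAbove)
  (≡-irrelevant P.endOnDiagonal Q.endOnDiagonal)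
  where
  module P = IsMotzkin p
  module Q = IsMotzkin q

motzkin-≡ : ∀ {n} {P Q : Motzkin n} → Motzkin.word P ≡ Motzkin.word Q → P ≡ Q
motzkin-≡ {P = record { isMotzkin = p ; size = s }} {record { isMotzkin = q ; size = t }} refl
  with isMotzkin-irrelevant p q | ≡-irrelevant s t
... | refl | refl = refl

dyck-≡ : ∀ {m} {R S : Dyck m} → Dyck.word R ≡ Dyck.word S → R ≡ S
dyck-≡ {R = record { isMotzkin = p ; noD = a ; size = s }}
       {record { isMotzkin = q ; noD = b ; size = t }} refl
  with isMotzkin-irrelevant p q | All.irrelevant (λ _ _ → refl) a b | ≡-irrelevant s t
... | refl | refl | refl = refl

path : ∀ {n} (P : Motzkin n) → Path 0 (Motzkin.word P)
path P = isMotzkin⇒path (Motzkin.isMotzkin P)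

dyckPath : ∀ {m} (R : Dyck m) → Path 0 (Dyck.word R)
dyckPath R = isMotzkin⇒path (Dyck.isMotzkin R)

toDyck : ∀ {n} → Motzkin n → Dyck (2 * n)
toDyck P = record
  { word      = inflate word
  ; isMotzkin = path⇒isMotzkin (IsMotzkin.nonEmpty isMotzkin ∘ inflate-injective)
                               (inflate-path (path P))
  ; noD       = inflate-noD word
  ; size      = trans (sym (ℕ.+-identityʳ _)) (trans (inflate-length (path P)) (cong (2 *_) size))
  }
  where open Motzkin P

toDyck-onto : ∀ {n} (R : Dyck (2 * n)) → Blocks (northLetters (Dyck.word R)) →
              ∃[ P ] toDyck {n} P ≡ R
toDyck-onto {n} R b with deflate (Dyck.word R) (Dyck.noD R) b
... | w , eq = P , dyck-≡ (sym eq)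
  where
  p : Path 0 w
  p = deflate-path w (subst (Path 0) eq (dyckPath R))
  P : Motzkin n
  P = record
    { word      = w
    ; isMotzkin = path⇒isMotzkin (λ { refl → IsMotzkin.nonEmpty (Dyck.isMotzkin R) eq }) p
    ; size      = ℕ.*-cancelˡ-≡ _ _ 2 (begin
        2 * length w              ≡⟨ inflate-length p ⟨
        length (inflate w) + 0    ≡⟨ ℕ.+-identityʳ _ ⟩
        length (inflate w)        ≡⟨ cong length eq ⟨
        length (Dyck.word R)      ≡⟨ Dyck.size R ⟩
        2 * n                     ∎)
    }
    where open ≡-Reasoning

slide-nonEmpty : ∀ {F u w} → Slide F u w → w ≢ []
slide-nonEmpty (here {[]} _ _)    ()
slide-nonEmpty (here {_ ∷ _} _ _) ()

-- Slides preserve paths and lengths, so the intermediate words are Motzkin paths of the same size.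
-- The target is an equation between words, since the other fields agree only through `motzkin-≡`.
lift : ∀ {F n} → (Slide F ⇒ _⊲_) → (P Q : Motzkin n) →
       Star (Slide F) (Motzkin.word P) (Motzkin.word Q) → Star (Slide F on Motzkin.word) P Q
lift {F} {n} F⇒⊲ P Q rs = go P rs refl
  where
  go : ∀ {w} (P : Motzkin n) → Star (Slide F) (Motzkin.word P) w → w ≡ Motzkin.word Q →
       Star (Slide F on Motzkin.word) P Q
  go P ε        eq rewrite motzkin-≡ {P = P} {Q} eq = ε
  go P (r ◅ rs) eq = r ◅ go next rs eq
    where
    next : Motzkin n
    next = record
      { isMotzkin = path⇒isMotzkin (slide-nonEmpty r) (slide-path (F⇒⊲ r) (path P))
      ; size      = trans (sym (slide-length r)) (Motzkin.size P)
      }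

⊲*⇒≤ : ∀ {n} (P Q : Motzkin n) → Star _⊲_ (Motzkin.word P) (Motzkin.word Q) →
       Star (_⋖_ on Motzkin.word) P Q
⊲*⇒≤ P Q rs = Star.map ⊲⇒⋖ (lift id P Q rs)

≤⇒⊲* : ∀ {A : Set} (word : A → List Step) {x y} → Star (_⋖_ on word) x y →
       Star _⊲_ (word x) (word y)
≤⇒⊲* word = Star.gmap word ⋖⇒⊲

toDyck-mono : ∀ {n} {P Q : Motzkin n} → Star (_⋖_ on Motzkin.word) P Q →
              Star (_⋖_ on Dyck.word) (toDyck P) (toDyck Q)
toDyck-mono = Star.gmap toDyck (⊲⇒⋖ ∘ inflate-slide ∘ ⋖⇒⊲)

toDyck-cancel : ∀ {n} {P Q : Motzkin n} → letters (Motzkin.word P) ≡ letters (Motzkin.word Q) →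
                Star (_⋖_ on Dyck.word) (toDyck P) (toDyck Q) → Star (_⋖_ on Motzkin.word) P Q
toDyck-cancel {P = P} {Q} eq rs =
  ⊲*⇒≤ P Q (deflate-slides (Motzkin.word P) (≤⇒⊲* Dyck.word rs) refl eq)

≤-letters : ∀ {n} {P Q : Motzkin n} → Star (_⋖_ on Motzkin.word) P Q →
            letters (Motzkin.word P) ≡ letters (Motzkin.word Q)
≤-letters ε        = refl
≤-letters (r ◅ rs) = trans (slide-letters (⋖⇒⊲ r)) (≤-letters rs)

motzkin-letters-length : ∀ {n} (P : Motzkin n) → length (letters (Motzkin.word P)) ≡ n
motzkin-letters-length P =
  trans (sym (ℕ.+-identityʳ _)) (trans (letters-length (path P)) (Motzkin.size P))

cls-heights : ∀ {n} (P : Motzkin n) → cls P ≡ heights 0ℤ (letters (Motzkin.word P))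
cls-heights P = diagonalHeights-letters origin (Motzkin.word P)

letters⇒cls : ∀ {n} {P Q : Motzkin n} → letters (Motzkin.word P) ≡ letters (Motzkin.word Q) →
              cls P ≡ cls Q
letters⇒cls {P = P} {Q} eq = trans (cls-heights P) (trans (cong (heights 0ℤ) eq) (sym (cls-heights Q)))

cls⇒letters : ∀ {n} {P Q : Motzkin n} → cls P ≡ cls Q →
              letters (Motzkin.word P) ≡ letters (Motzkin.word Q)
cls⇒letters {P = P} {Q} eq = heights-injective 0ℤ
  (letters-blocks (Motzkin.word P)) (letters-blocks (Motzkin.word Q))
  (trans (sym (cls-heights P)) (trans eq (cls-heights Q)))
  (trans (motzkin-letters-length P) (sym (motzkin-letters-length Q)))

-- Components

module _ {n : ℕ} where
  private
    𝓜 = MotzkinPoset n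
    module 𝓜 = Poset 𝓜

    A : Motzkin n → ℕ
    A P = area 0 (Motzkin.word P)

  ≤⇒area≤ : ∀ {P Q} → P 𝓜.≤ Q → A P ≤ A Q
  ≤⇒area≤ ε        = ℕ.≤-refl
  ≤⇒area≤ (r ◅ rs) = ℕ.≤-trans (ℕ.<⇒≤ (slide-area (⋖⇒⊲ r) 0)) (≤⇒area≤ rs)

  <⇒area< : ∀ {P Q} → P 𝓜.≤ Q → P ≢ Q → A P < A Q
  <⇒area< ε        P≢Q = contradiction refl P≢Q
  <⇒area< (r ◅ rs) _   = ℕ.<-≤-trans (slide-area (⋖⇒⊲ r) 0) (≤⇒area≤ rs)

  -- Areas increase strictly along the order and those of `P` and `Q` differ by one, which leaves no
  -- room in between.
  peak⇒hasse : ∀ {P Q} → Motzkin.word P ⊲ₚ Motzkin.word Q → HasseEdge 𝓜 P Q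
  peak⇒hasse {P} {Q} r =
    ((⊲⇒⋖ (⊲ₚ⇒⊲ r) ◅ ε) , λ { refl → ℕ.1+n≢n (sym (peak-area r 0)) }) ,
    λ { z ((P≤z , P≢z) , (z≤Q , z≢Q)) → ℕ.<⇒≱ (<⇒area< z≤Q z≢Q)
          (subst (_≤ A z) (sym (peak-area r 0)) (<⇒area< P≤z P≢z)) }

  connected⇒cls : ∀ {P Q} → Connected 𝓜 P Q → cls P ≡ cls Q
  connected⇒cls = EqClosure.gfold isEquivalence cls
    (λ {P} {Q} e → letters⇒cls {P = P} {Q} (≤-letters (proj₁ (proj₁ e))))

-- Lists and vectors

take-length-++ : ∀ {A : Set} (k l : List A) → take (length k) (k ++ l) ≡ k
take-length-++ []      l = refl
take-length-++ (x ∷ k) l = cong (x ∷_) (take-length-++ k l)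

length-∷ʳ : ∀ {A : Set} (l : List A) {x} → length (l ∷ʳ x) ≡ suc (length l)
length-∷ʳ []      = refl
length-∷ʳ (_ ∷ l) = cong suc (length-∷ʳ l)

toVec : ∀ {A : Set} {m} (l : List A) → length l ≡ m → Σ[ v ∈ Vec A m ] toList v ≡ l
toVec l refl = fromList l , toList∘fromList l

-- Least and greatest paths, and components as classes

module _ (m : ℕ) where
  private
    n = suc m
    𝓜 = MotzkinPoset n
    Words = Σ[ ν ∈ Vec Letter m ] AvoidsEE ν
    𝓓 = ⨄ (λ (ν : Words) → DyckOfType n (proj₁ ν))
    module 𝓜 = Poset 𝓜
    module 𝓓 = Poset 𝓓
    module 𝓣 = Poset (Tamari n)

  mkMotzkin : ∀ {w} → Path 0 w → length (letters w) ≡ n → Motzkin n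
  mkMotzkin {w} p len = record
    { word      = w
    ; isMotzkin = path⇒isMotzkin (λ { refl → ℕ.0≢1+n len }) p
    ; size      = trans (sym (letters-length p)) (trans (ℕ.+-identityʳ _) len)
    }

  least greatest : ∀ {l} → Blocks l → length l ≡ n → Motzkin n
  least    b len = mkMotzkin (bot-path b)   (trans (cong length (bot-letters b)) len)
  greatest b len = mkMotzkin (top-path 0 b) (trans (cong length (top-letters 0 b)) len)

  module _ (P : Motzkin n) {l} (l≡ : letters (Motzkin.word P) ≡ l)
           (b : Blocks l) (len : length l ≡ n) where

    least-peaks : Star (_⊲ₚ_ on Motzkin.word) (least b len) P
    least-peaks = lift ⊲ₚ⇒⊲ _ _
      (subst (λ k → Star _⊲ₚ_ (bot k) (Motzkin.word P)) l≡ (bot-minimum (path P)))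

    least-≤ : least b len 𝓜.≤ P
    least-≤ = Star.map (⊲⇒⋖ ∘ ⊲ₚ⇒⊲) least-peaks

    ≤-greatest : P 𝓜.≤ greatest b len
    ≤-greatest = ⊲*⇒≤ _ _
      (subst (λ k → Star _⊲_ (Motzkin.word P) (top 0 k)) l≡ (top-maximum (path P)))

    least-connected : Connected 𝓜 (least b len) P
    least-connected = Star.map (λ r → fwd (peak⇒hasse r)) least-peaks

  -- Paths of the same size and class have the same letters, hence the same least path, to which
  -- both are connected.
  cls⇒connected : ∀ {P Q} → cls P ≡ cls Q → Connected 𝓜 P Q
  cls⇒connected {P} {Q} eq =
    EqClosure.symmetric _ (least-connected P refl b len)
    ◅◅ least-connected Q (sym (cls⇒letters {P = P} {Q} eq)) b len
    where
    b   = letters-blocks (Motzkin.word P)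
    len = motzkin-letters-length P

  components : ∀ (S : Pred 𝓜.Carrier 0ℓ) →
    IsComponent 𝓜 S ⇔ (∃[ c ] Satisfiable S × (∀ P → S P ⇔ cls P ≡ c))
  components S = mk⇔
    (λ { (x , S⇔) → cls x , (x , from (S⇔ x) ε) , λ P → mk⇔
         (λ s → sym (connected⇒cls (to (S⇔ P) s)))
         (λ eq → from (S⇔ P) (cls⇒connected (sym eq))) })
    (λ { (c , (x , s) , S⇔) → x , λ P → mk⇔
         (λ s′ → cls⇒connected (trans (to (S⇔ x) s) (sym (to (S⇔ P) s′))))
         (λ x~P → from (S⇔ P) (trans (sym (connected⇒cls x~P)) (to (S⇔ x) s))) })
    where open Equivalence

  -- Types of Dyck paths, and intervals

  type-∷ʳ : (R : Dyck (2 * n)) → northLetters (Dyck.word R) ≡ Type n R ∷ʳ N × length (Type n R) ≡ m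
  type-∷ʳ R with northLetters-last (dyckPath R) (Dyck.noD R)
                | northLetters-length (dyckPath R) (Dyck.noD R)
  -- Without north steps the size would be 0, but `n` is `suc m`.
  ... | inj₁ eq       | len with trans (sym (cong (λ l → 2 * length l + 0) eq)) (trans len (Dyck.size R))
  ...   | ()
  type-∷ʳ R | inj₂ (l , eq) | len = trans eq (cong (_∷ʳ N) (sym type≡)) , trans (cong length type≡) length≡
    where
    length≡ : length l ≡ m
    length≡ = ℕ.suc-injective (trans (sym (length-∷ʳ l)) (trans (cong length (sym eq))
      (ℕ.*-cancelˡ-≡ _ _ 2 (trans (sym (ℕ.+-identityʳ _)) (trans len (Dyck.size R))))))
    type≡ : Type n R ≡ l
    type≡ = trans (cong₂ take (sym length≡) eq) (take-length-++ l (N ∷ []))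

  type-toDyck : (P : Motzkin n) → Type n (toDyck P) ∷ʳ N ≡ letters (Motzkin.word P)
  type-toDyck P = trans (sym (proj₁ (type-∷ʳ (toDyck P)))) (northLetters-inflate (Motzkin.word P))

  -- The letter that `Type` cuts off is always N, so the type can be replaced by the full word of
  -- letters, which slides control.
  hasType⇔ : ∀ ν R → HasType n ν R ⇔ northLetters (Dyck.word R) ≡ toList ν ∷ʳ N
  hasType⇔ ν R = mk⇔
    (λ t → trans (proj₁ (type-∷ʳ R)) (cong (_∷ʳ N) t))
    (λ eq → ∷ʳ-injectiveˡ _ _ (trans (sym (proj₁ (type-∷ʳ R))) eq))

  -- The ends are the images of the least and the greatest Motzkin path with letters `ν` N. A path
  -- of type `ν` is itself an image, and its bounds carry over; the letters of a path between the
  -- ends are squeezed between equal words.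
  intervals : ∀ (ν : Words) → IsInterval (Tamari n) (HasType n (proj₁ ν))
  intervals (ν , av) =
    toDyck lo , toDyck hi , toDyck-mono (least-≤ hi (top-letters 0 b) b len) , λ R → mk⇔
      (within R ∘ to (hasType⇔ ν R))
      (λ { (lo≤R , R≤hi) → from (hasType⇔ ν R) (⊑*-antisym
             (subst (Pointwise _⊑_ _) (extreme hi (top-letters 0 b)) (≤-northLetters R≤hi))
             (subst (λ k → Pointwise _⊑_ k _) (extreme lo (bot-letters b)) (≤-northLetters lo≤R))) })
    where
    open Equivalence
    l = toList ν ∷ʳ N
    b : Blocks l
    b = avoid-blocks (toList ν) av
    len : length l ≡ n
    len = trans (length-∷ʳ (toList ν)) (cong suc (length-toList ν))
    lo = least b len
    hi = greatest b len
    extreme : (P : Motzkin n) → letters (Motzkin.word P) ≡ l →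
              northLetters (Dyck.word (toDyck P)) ≡ l
    extreme P = trans (northLetters-inflate (Motzkin.word P))
    ≤-northLetters : ∀ {R S} → R 𝓣.≤ S →
      Pointwise _⊑_ (northLetters (Dyck.word R)) (northLetters (Dyck.word S))
    ≤-northLetters = slides-northLetters ∘ ≤⇒⊲* Dyck.word
    within : ∀ R → northLetters (Dyck.word R) ≡ l → toDyck lo 𝓣.≤ R × R 𝓣.≤ toDyck hi
    within R eq with toDyck-onto {n} R (subst Blocks (sym eq) b)
    ... | P , refl = toDyck-mono (least-≤ P l≡ b len) , toDyck-mono (≤-greatest P l≡ b len)
      where
      l≡ : letters (Motzkin.word P) ≡ l
      l≡ = trans (sym (northLetters-inflate (Motzkin.word P))) eq

  -- The order isomorphism

  dyck : 𝓓.Carrier → Dyck (2 * n)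
  dyck x = proj₁ (proj₂ x)

  -- The type of a path determines the word that indexes its fibre, and two proofs of `AvoidsEE` are
  -- definitionally equal.
  fibrewise : (R : Rel (Dyck (2 * n)) 0ℓ) (x y : 𝓓.Carrier) →
    Type n (dyck x) ≡ Type n (dyck y) → R (dyck x) (dyck y) →
    Fibrewise {C = λ (ν : Words) → Σ (Dyck (2 * n)) (HasType n (proj₁ ν))} (λ _ → R on proj₁) x y
  fibrewise R ((ν , _) , (_ , t)) ((ν′ , _) , (_ , t′)) eq r
    with trans (sym (cast-is-id refl ν)) (toList-injective refl ν ν′ (trans (sym t) (trans eq t′)))
  ... | refl = fibre r

  φ⁻¹ : 𝓜.Carrier → 𝓓.Carrier
  φ⁻¹ P = (ν , av) , (toDyck P , sym ν≡)
    where
    v  = toVec (Type n (toDyck P)) (proj₂ (type-∷ʳ (toDyck P)))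
    ν  = proj₁ v
    ν≡ = proj₂ v
    av : AvoidsEE ν
    -- A factor E E of `ν` remains one when the final N is appended.
    av u w eq = blocks-avoid (letters-blocks (Motzkin.word P)) u (w ∷ʳ N) (begin
      letters (Motzkin.word P)     ≡⟨ type-toDyck P ⟨
      Type n (toDyck P) ∷ʳ N       ≡⟨ cong (_∷ʳ N) ν≡ ⟨
      toList ν ∷ʳ N                ≡⟨ cong (_∷ʳ N) eq ⟩
      (u ++ E ∷ E ∷ w) ∷ʳ N        ≡⟨ ++-assoc u (E ∷ E ∷ w) (N ∷ []) ⟩
      u ++ E ∷ E ∷ w ∷ʳ N          ∎)
      where open ≡-Reasoning

  isOrderIsomorphism : IsOrderIsomorphism 𝓜._≈_ 𝓓._≈_ 𝓜._≤_ 𝓓._≤_ φ⁻¹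
  isOrderIsomorphism = record
    { isOrderMonomorphism = record
      { isOrderHomomorphism = record
        { cong = λ { refl → 𝓓.Eq.refl }
        ; mono = λ {P} {Q} P≤Q → fibrewise 𝓣._≤_ (φ⁻¹ P) (φ⁻¹ Q)
            (∷ʳ-injectiveˡ _ _ (trans (type-toDyck P) (trans (≤-letters P≤Q) (sym (type-toDyck Q)))))
            (toDyck-mono P≤Q)
        }
      ; injective = λ eq → motzkin-≡ (inflate-injective (cong Dyck.word (fibre-≡ eq)))
      ; cancel    = λ {P} {Q} → cancel P Q
      }
    ; surjective = surjective
    }
    where
    fibre-≡ : ∀ {x y} → x 𝓓.≈ y → dyck x ≡ dyck y
    fibre-≡ (fibre eq) = eq

    fibre-≤ : ∀ {x y} → x 𝓓.≤ y → Type n (dyck x) ≡ Type n (dyck y) × dyck x 𝓣.≤ dyck y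
    fibre-≤ (fibre {_} {_ , s} {_ , t} r) = trans s (sym t) , r

    cancel : ∀ P Q → φ⁻¹ P 𝓓.≤ φ⁻¹ Q → P 𝓜.≤ Q
    -- Comparable elements of the disjoint union have the same type, so `P` and `Q` have the same
    -- letters, as deflating the chain requires.
    cancel P Q le with fibre-≤ le
    ... | type≡ , r = toDyck-cancel
      (trans (sym (type-toDyck P)) (trans (cong (_∷ʳ N) type≡) (type-toDyck Q))) r

    surjective : ∀ y → ∃[ P ] (∀ {Q} → Q ≡ P → φ⁻¹ Q 𝓓.≈ y)
    surjective y@((ν , av) , (R , t))
      with toDyck-onto {n} R (subst Blocks (sym (Equivalence.to (hasType⇔ ν R) t)) (avoid-blocks (toList ν) av))
    ... | P , refl = P , λ { refl → fibrewise _≡_ (φ⁻¹ P) y refl refl }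

corollary3p4 :
    (n : ℕ) → 1 ≤ n →
    let 𝓜 = MotzkinPoset n
        Words = Σ[ ν ∈ Vec Letter (n ∸ 1) ] AvoidsEE ν
        𝓓 = ⨄ (λ (ν : Words) → DyckOfType n (proj₁ ν))
        module 𝓜 = Poset 𝓜
        module 𝓓 = Poset 𝓓
    in
    (∀ (ν : Words) → IsInterval (Tamari n) (HasType n (proj₁ ν)))
    × (Σ[ φ⁻¹ ∈ (𝓜.Carrier → 𝓓.Carrier) ]
        (∀ P → φ⟨ Dyck.word (proj₁ (proj₂ (φ⁻¹ P))) ⟩≡ Motzkin.word P)
        × IsOrderIsomorphism 𝓜._≈_ 𝓓._≈_ 𝓜._≤_ 𝓓._≤_ φ⁻¹)
    × (∀ (S : Pred 𝓜.Carrier 0ℓ) →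
        IsComponent 𝓜 S
        ⇔ (∃[ c ] Satisfiable S × (∀ P → S P ⇔ cls P ≡ c)))
corollary3p4 (suc m) _ =
  intervals m ,
  (φ⁻¹ m , (λ P → inflate-graph (path P)) , isOrderIsomorphism m) ,
  components m
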